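{- Let $\mathbb{0}=\{x\in\omega^\omega : x(n)=0 \text{ for all but finitely many } n\}$. Then every maximal antichain of $(\omega^\omega\setminus\mathbb{0},\le^*)$ has size $\mathfrak{c}$; i.e. $\mathfrak{mac}(\omega^\omega\setminus\mathbb{0},\le^*)=\mathfrak{c}$.
   Context: For $x,y\in\omega^\omega$, $x\le^* y$ means $x(n)\le y(n)$ for all but finitely many $n$. For a poset (or preorder) $(P,\le)$, an antichain is a subset whose elements are pairwise incomparable (neither $p\le q$ nor $q\le p$ for distinct members), and $\mathfrak{mac}(P)$ is the minimal cardinality of a maximal (with respect to inclusion) antichain of $P$. $\mathfrak{c}=2^{\aleph_0}$. -}

module Defs where

open import Data.Bool.Base using (Bool)
open import Data.List.Base using (List; []; _++_)
open import Data.List.Membership.Propositional using (_∉_)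
open import Data.List.Membership.Propositional.Properties using (∈-++⁺ˡ; ∈-++⁺ʳ)
open import Data.Nat.Base using (ℕ; _≤_)
open import Data.Nat.Properties using (≤-reflexive; ≤-trans)
open import Data.Product.Base using (∃-syntax; _×_; _,_; proj₁)
open import Function.Base using (_∘_)
open import Function.Bundles using (Bijection; Injection)
open import Level using (0ℓ)
open import Relation.Binary.Bundles using (Preorder; Setoid)
open import Relation.Binary.PropositionalEquality using (_≡_; _→-setoid_)
open import Relation.Nullary.Negation.Core using (¬_)
open import Relation.Unary using (Pred; _∈_; _⊆_)
import Relation.Binary.Construct.On as On

-- Cardinality.  Sets are setoids, and a cardinal is represented by any set
-- having that cardinality.

_HasSize_ : Setoid 0ℓ 0ℓ → Setoid 0ℓ 0ℓ → Set
S HasSize κ = Bijection S κ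

_HasSizeAtLeast_ : Setoid 0ℓ 0ℓ → Setoid 0ℓ 0ℓ → Set
S HasSizeAtLeast κ = Injection κ S

𝔠 : Setoid 0ℓ 0ℓ
𝔠 = ℕ →-setoid Bool

-- Antichains of a preorder.  _≈_ is equality of elements; it is in general
-- finer than "p ≲ q and q ≲ p".

module _ (P : Preorder 0ℓ 0ℓ 0ℓ) where
  open Preorder P using (Carrier; _≈_; _≲_; module Eq)

  IsAntichain : Pred Carrier 0ℓ → Set
  IsAntichain M = ∀ {p q} → p ∈ M → q ∈ M → ¬ (p ≈ q) → ¬ (p ≲ q) × ¬ (q ≲ p)

  -- Maximality forces M to be closed under _≈_: adjoining an element equal
  -- to a member of an antichain gives an antichain again.
  IsMaximalAntichain : Pred Carrier 0ℓ → Set₁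
  IsMaximalAntichain M =
    IsAntichain M × (∀ (N : Pred Carrier 0ℓ) → IsAntichain N → M ⊆ N → N ⊆ M)

  -- Membership proofs are ignored when elements of M are compared.
  elementsOf : Pred Carrier 0ℓ → Setoid 0ℓ 0ℓ
  elementsOf M = On.setoid Eq.setoid (proj₁ {B = M})

  -- 𝔪𝔞𝔠(P) = κ
  𝔪𝔞𝔠≡ : Setoid 0ℓ 0ℓ → Set₁
  𝔪𝔞𝔠≡ κ =
    (∃[ M ] (IsMaximalAntichain M × elementsOf M HasSize κ)) ×
    (∀ M → IsMaximalAntichain M → elementsOf M HasSizeAtLeast κ)

-- The list contains all exceptions, and possibly other numbers.
ForAllButFinitelyMany : Pred ℕ 0ℓ → Set
ForAllButFinitelyMany Q = ∃[ exceptions ] (∀ n → n ∉ exceptions → Q n)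

ω^ω : Set
ω^ω = ℕ → ℕ

_≤*_ : ω^ω → ω^ω → Set
x ≤* y = ForAllButFinitelyMany (λ n → x n ≤ y n)

𝟘 : Pred ω^ω 0ℓ
𝟘 x = ForAllButFinitelyMany (λ n → x n ≡ 0)

≤*-preorder : Preorder 0ℓ 0ℓ 0ℓ
≤*-preorder = record
  { Carrier    = ω^ω
  ; _≈_        = Setoid._≈_ (ℕ →-setoid ℕ)
  ; _≲_        = _≤*_
  ; isPreorder = record
    { isEquivalence = Setoid.isEquivalence (ℕ →-setoid ℕ)
    ; reflexive     = λ x≗y → [] , λ n _ → ≤-reflexive (x≗y n)
    ; trans         = λ { (k , x≤y) (l , y≤z) → k ++ l , λ n n∉ →
                        ≤-trans (x≤y n (n∉ ∘ ∈-++⁺ˡ)) (y≤z n (n∉ ∘ ∈-++⁺ʳ k)) }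
    }
  }

ω^ω∖𝟘 : Preorder 0ℓ 0ℓ 0ℓ
ω^ω∖𝟘 = On.preorder ≤*-preorder (proj₁ {B = λ x → ¬ (x ∈ 𝟘)})

{-# OPTIONS --safe #-}

-- Fix x in a maximal antichain M, and an almost disjoint family (S f), f ∈ 2^ω,
-- of infinite subsets of the support of x.  For f ≠ g let p be x + 1 on S f,
-- x - 1 on S g and x elsewhere.  By maximality some m ∈ M is comparable with p,
-- and m ≠ x because p is incomparable with x.  If m ≤* p then {m > x} is
-- infinite and almost contained in S f, so m determines f; if p ≤* m then
-- {m < x} is infinite and almost contained in S g, so m determines g.  Hence
-- either every f is determined by some m in the first way, or some f is not,
-- and then every g ≠ f is determined by some m in the second way.  Both
-- cases inject 2^ω into M.
module Submission where

open import Defs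
open import Axiom.ExcludedMiddle using (ExcludedMiddle)
open import Axiom.Extensionality.Propositional using (Extensionality)
open import Data.Bool.Base using (Bool; true; false; T; not; _∨_)
open import Data.Bool.Properties using (T-∨; not-¬) renaming (_≟_ to _≟ᵇ_)
open import Data.Empty using (⊥-elim)
open import Data.List.Base using (List; []; _∷_; _++_; length; upTo; applyUpTo)
open import Data.List.Extrema.Nat using (max; xs≤max)
open import Data.List.Membership.Propositional.Properties
  using (∈-++⁺ˡ; ∈-++⁺ʳ; ∈-upTo⁺; ∈-applyUpTo⁺)
open import Data.List.Properties using (∷-injectiveˡ; ∷-injectiveʳ)
open import Data.List.Relation.Unary.All using (lookup)
open import Data.Nat.Base
  using (ℕ; zero; suc; pred; _*_; _≤_; _<_; z≤n; s≤s; s≤s⁻¹)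
open import Data.Nat.Properties
  using (≤-refl; ≤-reflexive; ≤-trans; <-≤-trans; ≤-<-trans; <⇒≤; <⇒≱; ≰⇒>; ≮⇒≥;
         <-irrefl; <-cmp; n≤1+n; n<1+n; pred[n]≤n; m≤n⇒m<n∨m≡n; m≤n*m;
         suc-injective; even≢odd; *-cancelˡ-≡)
open import Data.Product.Base using (∃; ∃-syntax; _×_; _,_; proj₁; proj₂)
open import Data.Sum.Base using (_⊎_; inj₁; inj₂; [_,_]′; map₂)
open import Function.Base using (_∘_; id)
open import Function.Bundles using (Bijection; Injection; module Equivalence)
open import Level using (0ℓ)
open import Relation.Binary.Bundles using (Preorder; Setoid)
open import Relation.Binary.Definitions using (tri<; tri≈; tri>)
open import Relation.Binary.PropositionalEquality
  using (_≡_; _≢_; refl; sym; trans; cong; subst; _≗_)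
open import Relation.Nullary using (¬_; yes; no; contradiction)
open import Relation.Nullary.Decidable using (⌊_⌋; toWitness; fromWitness)
open import Relation.Unary using (Pred)

-- Coding finite sequences by numbers

2*-injective : ∀ {m n} → 2 * m ≡ 2 * n → m ≡ n
2*-injective {m} {n} = *-cancelˡ-≡ m n 2

-- Bijective base 2, with digits 1 and 2 for `false` and `true`; there are no leading zeros, so
-- lists of different lengths get different codes.
encode : List Bool → ℕ
encode []          = 0
encode (false ∷ l) = suc (2 * encode l)
encode (true ∷ l)  = 2 * suc (encode l)

encode-injective : ∀ k l → encode k ≡ encode l → k ≡ l
encode-injective []          []          _  = refl
encode-injective []          (false ∷ l) ()
encode-injective []          (true ∷ l)  ()
encode-injective (false ∷ k) []          ()
encode-injective (true ∷ k)  []          ()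
encode-injective (false ∷ k) (false ∷ l) eq =
  cong (false ∷_) (encode-injective k l (2*-injective (suc-injective eq)))
encode-injective (false ∷ k) (true ∷ l)  eq =
  contradiction (sym eq) (even≢odd (suc (encode l)) (encode k))
encode-injective (true ∷ k)  (false ∷ l) eq =
  contradiction eq (even≢odd (suc (encode k)) (encode l))
encode-injective (true ∷ k)  (true ∷ l)  eq =
  cong (true ∷_) (encode-injective k l (suc-injective (2*-injective eq)))

length≤encode : ∀ l → length l ≤ encode l
length≤encode []          = z≤n
length≤encode (false ∷ l) = s≤s (≤-trans (length≤encode l) (m≤n*m (encode l) 2))
length≤encode (true ∷ l)  =
  ≤-trans (s≤s (length≤encode l)) (m≤n*m (suc (encode l)) 2)

-- The parity of the code tells whether the first component is zero, which makes injectivity a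
-- recursion.
pair : ℕ → ℕ → ℕ
pair zero    v = suc (2 * v)
pair (suc i) v = 2 * suc (pair i v)

pair-injective : ∀ i j {v w} → pair i v ≡ pair j w → i ≡ j × v ≡ w
pair-injective zero    zero    eq = refl , 2*-injective (suc-injective eq)
pair-injective zero    (suc j) {v} {w} eq =
  contradiction (sym eq) (even≢odd (suc (pair j w)) v)
pair-injective (suc i) zero    {v} {w} eq =
  contradiction eq (even≢odd (suc (pair i v)) w)
pair-injective (suc i) (suc j) eq
  with refl , v≡w ← pair-injective i j (suc-injective (2*-injective eq)) = refl , v≡w

prefix : (ℕ → Bool) → ℕ → List Bool
prefix f zero    = []
prefix f (suc n) = f 0 ∷ prefix (f ∘ suc) n

length-prefix : ∀ f n → length (prefix f n) ≡ n
length-prefix f zero    = refl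
length-prefix f (suc n) = cong suc (length-prefix (f ∘ suc) n)

prefix-agree : ∀ f g {m n i} → prefix f m ≡ prefix g n → i < m → f i ≡ g i
prefix-agree f g {suc m} {suc n} {zero}  eq _         = ∷-injectiveˡ eq
prefix-agree f g {suc m} {suc n} {suc i} eq (s≤s i<m) =
  prefix-agree (f ∘ suc) (g ∘ suc) (∷-injectiveʳ eq) i<m

-- The numbers `code f n` form the branch of `f` in the binary tree; distinct branches share only
-- finitely many nodes.
code : (ℕ → Bool) → ℕ → ℕ
code f n = encode (prefix f n)

n≤code : ∀ f n → n ≤ code f n
n≤code f n = ≤-trans (≤-reflexive (sym (length-prefix f n))) (length≤encode (prefix f n))

code-agree : ∀ f g {m n i} → code f m ≡ code g n → i < m → f i ≡ g i
code-agree f g {m} {n} eq = prefix-agree f g (encode-injective (prefix f m) (prefix g n) eq)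

-- The quantifier "for all but finitely many"

∀* : Pred ℕ 0ℓ → Set
∀* = ForAllButFinitelyMany

∀*-map : ∀ {Q R : Pred ℕ 0ℓ} → (∀ {n} → Q n → R n) → ∀* Q → ∀* R
∀*-map q⇒r (l , q) = l , λ n n∉ → q⇒r (q n n∉)

∀*-zip : ∀ {Q R : Pred ℕ 0ℓ} → ∀* Q → ∀* R → ∀* (λ n → Q n × R n)
∀*-zip (k , q) (l , r) = k ++ l , λ n n∉ → q n (n∉ ∘ ∈-++⁺ˡ) , r n (n∉ ∘ ∈-++⁺ʳ k)

∀*⇒eventually : ∀ {Q : Pred ℕ 0ℓ} → ∀* Q → ∃[ b ] (∀ n → b ≤ n → Q n)
∀*⇒eventually (l , q) =
  -- `suc` puts the bound strictly above every exception; the default `0` only matters for an empty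
  -- list.
  suc (max 0 l) , λ n b≤n → q n λ n∈l → <⇒≱ b≤n (lookup (xs≤max 0 l) n∈l)

eventually⇒∀* : ∀ {Q : Pred ℕ 0ℓ} b → (∀ n → b ≤ n → Q n) → ∀* Q
eventually⇒∀* b q = upTo b , λ n n∉ → q n (≮⇒≥ (n∉ ∘ ∈-upTo⁺))

step-<⇒mono-< : ∀ (e : ℕ → ℕ) → (∀ i → e i < e (suc i)) → ∀ {i j} → i < j → e i < e j
step-<⇒mono-< e step {i} {suc j} i<1+j with m≤n⇒m<n∨m≡n (s≤s⁻¹ i<1+j)
... | inj₁ i<j  = <-≤-trans (step-<⇒mono-< e step i<j) (<⇒≤ (step j))
... | inj₂ refl = step i

step-<⇒injective : ∀ (e : ℕ → ℕ) → (∀ i → e i < e (suc i)) → ∀ {i j} → e i ≡ e j → i ≡ j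
step-<⇒injective e step {i} {j} eq with <-cmp i j
... | tri< i<j _ _ = contradiction (step-<⇒mono-< e step i<j) (<-irrefl eq)
... | tri≈ _ i≡j _ = i≡j
... | tri> _ _ j<i = contradiction (step-<⇒mono-< e step j<i) (<-irrefl (sym eq))

step-<⇒n≤e[n] : ∀ (e : ℕ → ℕ) → (∀ i → e i < e (suc i)) → ∀ n → n ≤ e n
step-<⇒n≤e[n] e step zero    = z≤n
step-<⇒n≤e[n] e step (suc n) = ≤-<-trans (step-<⇒n≤e[n] e step n) (step n)

-- em applies to all types, not only to propositions, and its positive answers
-- carry a witness, so that it also serves as the axiom of choice.
module Classical (em : ∀ {ℓ} → ExcludedMiddle ℓ) (ext : ∀ {a b} → Extensionality a b) where

  ¬∀⇒∃¬ : ∀ {a b} {A : Set a} {B : A → Set b} → ¬ (∀ x → B x) → ∃[ x ] ¬ B x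
  ¬∀⇒∃¬ {B = B} ¬all with em {P = ∃[ x ] ¬ B x}
  ... | yes ex = ex
  ... | no ¬ex = contradiction all ¬all
    where
    all : ∀ x → B x
    all x with em {P = B x}
    ... | yes b = b
    ... | no ¬b = contradiction (x , ¬b) ¬ex

  -- Cantor-Bernstein for setoids

  module CantorBernstein {A B : Setoid 0ℓ 0ℓ} (F : Injection A B) (G : Injection B A) where
    private
      module A = Setoid A
      module B = Setoid B
      module F = Injection F
      module G = Injection G

    -- The elements of A whose backward orbit under g and f stops in A.
    data StopsInA : A.Carrier → Set where
      stop : ∀ {a} → (∀ b → ¬ (G.to b A.≈ a)) → StopsInA a
      step : ∀ {a a′} → StopsInA a → G.to (F.to a) A.≈ a′ → StopsInA a′

    StopsInA-resp : ∀ {a a′} → a A.≈ a′ → StopsInA a → StopsInA a′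
    StopsInA-resp a≈a′ (stop ∉g)  = stop λ b eq → ∉g b (A.trans eq (A.sym a≈a′))
    StopsInA-resp a≈a′ (step s e) = step s (A.trans e a≈a′)

    -- The graph of the bijection: `F` on orbits stopping in `A`, the inverse of `G` elsewhere. As a
    -- relation, it lets well-definedness be proved whatever witness `em` supplies.
    Matched : A.Carrier → B.Carrier → Set
    Matched a b = (StopsInA a × F.to a B.≈ b) ⊎ (¬ StopsInA a × G.to b A.≈ a)

    image : ∀ a → ∃ (Matched a)
    image a with em {P = StopsInA a}
    ... | yes s = F.to a , inj₁ (s , B.refl)
    ... | no ¬s with em {P = ∃[ b ] G.to b A.≈ a}
    ...   | yes (b , gb≈a) = b , inj₂ (¬s , gb≈a)
    ...   | no ∉g          = contradiction (stop λ b eq → ∉g (b , eq)) ¬s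

    functional : ∀ {a a′ b b′} → a A.≈ a′ → Matched a b → Matched a′ b′ → b B.≈ b′
    functional a≈a′ (inj₁ (s , e)) (inj₁ (s′ , e′)) =
      B.trans (B.sym e) (B.trans (F.cong a≈a′) e′)
    functional a≈a′ (inj₁ (s , e)) (inj₂ (¬s′ , e′)) =
      contradiction (StopsInA-resp a≈a′ s) ¬s′
    functional a≈a′ (inj₂ (¬s , e)) (inj₁ (s′ , e′)) =
      contradiction (StopsInA-resp (A.sym a≈a′) s′) ¬s
    functional a≈a′ (inj₂ (¬s , e)) (inj₂ (¬s′ , e′)) =
      G.injective (A.trans e (A.trans a≈a′ (A.sym e′)))

    -- In the mixed cases one point is `G` of `F` of the other, so stopping in `A` would pass to it
    -- by `step`.
    matched-injective : ∀ {a a′ b b′} → b B.≈ b′ → Matched a b → Matched a′ b′ → a A.≈ a′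
    matched-injective b≈b′ (inj₁ (s , e)) (inj₁ (s′ , e′)) =
      F.injective (B.trans e (B.trans b≈b′ (B.sym e′)))
    matched-injective b≈b′ (inj₁ (s , e)) (inj₂ (¬s′ , e′)) =
      contradiction (step s (A.trans (G.cong (B.trans e b≈b′)) e′)) ¬s′
    matched-injective b≈b′ (inj₂ (¬s , e)) (inj₁ (s′ , e′)) =
      contradiction (step s′ (A.trans (G.cong (B.trans e′ (B.sym b≈b′))) e)) ¬s
    matched-injective b≈b′ (inj₂ (¬s , e)) (inj₂ (¬s′ , e′)) =
      A.trans (A.sym e) (A.trans (G.cong b≈b′) e′)

    -- The orbit of `G.to b` decides. It cannot stop at `G.to b` itself, which comes from `b`; so if
    -- it stops in `A`, it passes through some `a` with `F.to a` equal to `b`.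
    preimage : ∀ b → ∃[ a ] Matched a b
    preimage b with em {P = StopsInA (G.to b)}
    ... | no ¬s                  = G.to b , inj₂ (¬s , A.refl)
    ... | yes (stop ∉g)          = contradiction A.refl (∉g b)
    ... | yes (step {a} s gfa≈gb) = a , inj₁ (s , G.injective gfa≈gb)

    bijection : Bijection A B
    bijection = record
      { to        = λ a → proj₁ (image a)
      ; cong      = λ {a} {a′} a≈a′ → functional a≈a′ (proj₂ (image a)) (proj₂ (image a′))
      ; bijective =
          (λ {a} {a′} eq → matched-injective eq (proj₂ (image a)) (proj₂ (image a′))) ,
          (λ b → let a , m = preimage b in
             a , λ {z} z≈a → functional z≈a (proj₂ (image z)) m)
      }

  -- Maximal antichains

  -- The Bourbaki–Witt argument: the sets obtained from ∅ by repeatedly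
  -- adjoining a chosen new element and taking unions form a chain.  Subsets are
  -- Bool-valued so that, by extensionality, mutual inclusion is equality and the
  -- choice of the new element depends only on the set.
  module Tower (P : Preorder 0ℓ 0ℓ 0ℓ) where
    open Preorder P using (Carrier; _≈_; _≲_; module Eq)

    Subset : Set
    Subset = Carrier → Bool

    _⊑_ : Subset → Subset → Set
    A ⊑ B = ∀ x → T (A x) → T (B x)

    T-extensional : ∀ {a b} → (T a → T b) → (T b → T a) → a ≡ b
    T-extensional {false} {false} _ _ = refl
    T-extensional {false} {true}  _ g = ⊥-elim (g _)
    T-extensional {true}  {false} f _ = ⊥-elim (f _)
    T-extensional {true}  {true}  _ _ = refl

    ⊑-antisym : ∀ {A B} → A ⊑ B → B ⊑ A → A ≡ B
    ⊑-antisym A⊑B B⊑A = ext λ x → T-extensional (A⊑B x) (B⊑A x)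

    Apart : Carrier → Carrier → Set
    Apart p q = ¬ (p ≈ q) → ¬ (p ≲ q) × ¬ (q ≲ p)

    Apart-sym : ∀ {p q} → Apart p q → Apart q p
    Apart-sym apart q≉p = let p≴q , q≴p = apart (q≉p ∘ Eq.sym) in q≴p , p≴q

    Addable : Subset → Carrier → Set
    Addable A x = ¬ T (A x) × (∀ y → T (A y) → Apart x y)

    extend : Subset → Subset
    extend A with em {P = ∃ (Addable A)}
    ... | yes (x , _) = λ z → A z ∨ ⌊ em {P = z ≡ x} ⌋
    ... | no _        = A

    ⊑-extend : ∀ A → A ⊑ extend A
    ⊑-extend A z z∈A with em {P = ∃ (Addable A)}
    ... | yes _ = Equivalence.from T-∨ (inj₁ z∈A)
    ... | no _  = z∈A

    extend-closed⇒maximal : ∀ {A} → extend A ⊑ A → ∀ x → ¬ Addable A x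
    extend-closed⇒maximal {A} closed x addable with em {P = ∃ (Addable A)}
    ... | yes (y , y∉A , _) = y∉A (closed y (Equivalence.from (T-∨ {A y}) (inj₂ (fromWitness refl))))
    ... | no none           = none (x , addable)

    extend-antichain : ∀ A → IsAntichain P (T ∘ A) → IsAntichain P (T ∘ extend A)
    extend-antichain A anti {p} {q} p∈ q∈ with em {P = ∃ (Addable A)}
    ... | no _ = anti p∈ q∈
    ... | yes (x , _ , apart)
      with map₂ toWitness (Equivalence.to T-∨ p∈) | map₂ toWitness (Equivalence.to T-∨ q∈)
    ... | inj₁ p∈A  | inj₁ q∈A  = anti p∈A q∈A
    ... | inj₁ p∈A  | inj₂ refl = Apart-sym (apart p p∈A)
    ... | inj₂ refl | inj₁ q∈A  = apart q q∈A
    ... | inj₂ refl | inj₂ refl = λ x≉x → contradiction Eq.refl x≉x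

    ⋃ : (Subset → Bool) → Subset
    ⋃ 𝒮 x = ⌊ em {P = ∃[ A ] (T (𝒮 A) × T (A x))} ⌋

    ⊑-⋃ : ∀ {𝒮 A} → T (𝒮 A) → A ⊑ ⋃ 𝒮
    ⊑-⋃ A∈𝒮 x x∈A = fromWitness (_ , A∈𝒮 , x∈A)

    ⋃-⊑ : ∀ {𝒮 B} → (∀ A → T (𝒮 A) → A ⊑ B) → ⋃ 𝒮 ⊑ B
    ⋃-⊑ below x x∈⋃ = let A , A∈𝒮 , x∈A = toWitness x∈⋃ in below A A∈𝒮 x x∈A

    -- The empty family makes ∅ a member. Since families are `Bool`-valued, `union` quantifies over
    -- a small type, and `em` can turn the tower itself into such a family.
    data InTower : Subset → Set where
      extended : ∀ {A} → InTower A → InTower (extend A)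
      union    : ∀ {𝒮} → (∀ A → T (𝒮 A) → InTower A) → InTower (⋃ 𝒮)

    -- Extreme points as in the Bourbaki-Witt proof: growing a smaller member by one step does not
    -- jump past `B`.
    Extreme : Subset → Set
    Extreme B = ∀ {A} → InTower A → A ⊑ B → A ≢ B → extend A ⊑ B

    -- Induction over the tower: at a union, either one member already contains `extend B`, or all
    -- of them lie below `B`.
    extreme⇒comparable : ∀ {A B} → Extreme B → InTower A → A ⊑ B ⊎ extend B ⊑ A
    extreme⇒comparable {B = B} extreme (extended {A} tA) with extreme⇒comparable extreme tA
    ... | inj₂ sB⊑A = inj₂ λ x → ⊑-extend A x ∘ sB⊑A x
    ... | inj₁ A⊑B with em {P = A ≡ B}
    ...   | yes refl = inj₂ λ _ → id
    ...   | no A≢B   = inj₁ (extreme tA A⊑B A≢B)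
    extreme⇒comparable {B = B} extreme (union {𝒮} t𝒮)
      with em {P = ∃[ A ] (T (𝒮 A) × extend B ⊑ A)}
    ... | yes (A , A∈𝒮 , sB⊑A) = inj₂ λ x → ⊑-⋃ A∈𝒮 x ∘ sB⊑A x
    ... | no none = inj₁ (⋃-⊑ below)
      where
      below : ∀ A → T (𝒮 A) → A ⊑ B
      below A A∈𝒮 with extreme⇒comparable extreme (t𝒮 A A∈𝒮)
      ... | inj₁ A⊑B  = A⊑B
      ... | inj₂ sB⊑A = contradiction (A , A∈𝒮 , sB⊑A) none

    extreme : ∀ {B} → InTower B → Extreme B
    extreme (extended {B} tB) {A} tA A⊑sB A≢sB with extreme⇒comparable (extreme tB) tA
    ... | inj₂ sB⊑A = contradiction (⊑-antisym A⊑sB sB⊑A) A≢sB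
    ... | inj₁ A⊑B with em {P = A ≡ B}
    ...   | yes refl = λ _ → id
    ...   | no A≢B   = λ x → ⊑-extend B x ∘ extreme tB tA A⊑B A≢B x
    extreme (union {𝒮} t𝒮) {A} tA A⊑⋃ A≢⋃ with em {P = ∃[ B ] (T (𝒮 B) × A ⊑ B)}
    ... | no none = contradiction (⊑-antisym A⊑⋃ (⋃-⊑ below)) A≢⋃
      where
      below : ∀ B → T (𝒮 B) → B ⊑ A
      below B B∈𝒮 with extreme⇒comparable (extreme (t𝒮 B B∈𝒮)) tA
      ... | inj₁ A⊑B  = contradiction (B , B∈𝒮 , A⊑B) none
      ... | inj₂ sB⊑A = λ x → sB⊑A x ∘ ⊑-extend B x
    ... | yes (B , B∈𝒮 , A⊑B) with em {P = A ≡ B}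
    ...   | no A≢B = λ x → ⊑-⋃ B∈𝒮 x ∘ extreme (t𝒮 B B∈𝒮) tA A⊑B A≢B x
    -- Here `A` itself lies in the family, and its own extremeness compares it with the strictly
    -- larger union.
    ...   | yes refl with extreme⇒comparable (extreme (t𝒮 B B∈𝒮)) (union t𝒮)
    ...     | inj₁ ⋃⊑A  = contradiction (⊑-antisym A⊑⋃ ⋃⊑A) A≢⋃
    ...     | inj₂ sA⊑⋃ = sA⊑⋃

    tower-linear : ∀ {A B} → InTower A → InTower B → A ⊑ B ⊎ B ⊑ A
    tower-linear {B = B} tA tB with extreme⇒comparable (extreme tB) tA
    ... | inj₁ A⊑B  = inj₁ A⊑B
    ... | inj₂ sB⊑A = inj₂ λ x → sB⊑A x ∘ ⊑-extend B x

    tower-antichain : ∀ {A} → InTower A → IsAntichain P (T ∘ A)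
    tower-antichain (extended {A} tA) = extend-antichain A (tower-antichain tA)
    tower-antichain (union {𝒮} t𝒮) {p} {q} p∈ q∈
      with A , A∈𝒮 , p∈A ← toWitness p∈ | B , B∈𝒮 , q∈B ← toWitness q∈
      -- Linearity puts both elements into a single member of the family.
      with tower-linear (t𝒮 A A∈𝒮) (t𝒮 B B∈𝒮)
    ... | inj₁ A⊑B = tower-antichain (t𝒮 B B∈𝒮) (A⊑B p p∈A) q∈B
    ... | inj₂ B⊑A = tower-antichain (t𝒮 A A∈𝒮) p∈A (B⊑A q q∈B)

    𝒯 : Subset → Bool
    𝒯 A = ⌊ em {P = InTower A} ⌋

    top-inTower : InTower (⋃ 𝒯)
    top-inTower = union λ _ → toWitness

    -- The union of the whole tower is its largest member, and its extension is again a member.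
    top-closed : extend (⋃ 𝒯) ⊑ ⋃ 𝒯
    top-closed = ⊑-⋃ (fromWitness (extended top-inTower))

    maximalAntichain : ∃ (IsMaximalAntichain P)
    maximalAntichain = T ∘ ⋃ 𝒯 , tower-antichain top-inTower , maximal
      where
      maximal : ∀ N → IsAntichain P N → (∀ {x} → T (⋃ 𝒯 x) → N x) → ∀ {x} → N x → T (⋃ 𝒯 x)
      maximal N anti top⊆N {x} x∈N with em {P = T (⋃ 𝒯 x)}
      ... | yes x∈top = x∈top
      ... | no x∉top  = contradiction
        (x∉top , λ y y∈top → anti x∈N (top⊆N y∈top))
        (extend-closed⇒maximal top-closed x)

  module _ (P : Preorder 0ℓ 0ℓ 0ℓ) where
    open Preorder P using (Carrier; _≈_; _≲_; module Eq) renaming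
      (refl to ≲-refl; reflexive to ≲-reflexive; trans to ≲-trans)

    -- Without a comparable member, `M` enlarged by everything equal to `p` is an antichain;
    -- maximality then puts `p` into `M`, where it is comparable with itself.
    maximal⇒comparable : ∀ {M} → IsMaximalAntichain P M →
      ∀ p → ∃[ m ] (M m × (m ≲ p ⊎ p ≲ m))
    maximal⇒comparable {M} (anti , maximal) p
      with em {P = ∃[ m ] (M m × (m ≲ p ⊎ p ≲ m))}
    ... | yes ex = ex
    ... | no none = p , maximal N N-anti inj₁ (inj₂ Eq.refl) , inj₁ ≲-refl
      where
      N : Pred Carrier 0ℓ
      N q = M q ⊎ q ≈ p
      N-anti : IsAntichain P N
      N-anti (inj₁ q∈M) (inj₁ r∈M) = anti q∈M r∈M
      N-anti (inj₁ q∈M) (inj₂ r≈p) _ =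
        (λ q≲r → none (_ , q∈M , inj₁ (≲-trans q≲r (≲-reflexive r≈p)))) ,
        (λ r≲q → none (_ , q∈M , inj₂ (≲-trans (≲-reflexive (Eq.sym r≈p)) r≲q)))
      N-anti (inj₂ q≈p) (inj₁ r∈M) _ =
        (λ q≲r → none (_ , r∈M , inj₂ (≲-trans (≲-reflexive (Eq.sym q≈p)) q≲r))) ,
        (λ r≲q → none (_ , r∈M , inj₁ (≲-trans r≲q (≲-reflexive q≈p))))
      N-anti (inj₂ q≈p) (inj₂ r≈p) q≉r =
        contradiction (Eq.trans q≈p (Eq.sym r≈p)) q≉r

  -- Almost disjoint subsets of the support, and perturbing `x` along them

  module AlmostDisjoint {x : ω^ω} (x∉𝟘 : ¬ 𝟘 x) where

    support-unbounded : ∀ b → ∃[ n ] (b ≤ n × x n ≢ 0)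
    support-unbounded b with em {P = ∃[ n ] (b ≤ n × x n ≢ 0)}
    ... | yes ex = ex
    ... | no none = contradiction (eventually⇒∀* b vanishes) x∉𝟘
      where
      vanishes : ∀ n → b ≤ n → x n ≡ 0
      vanishes n b≤n with em {P = x n ≡ 0}
      ... | yes xn≡0 = xn≡0
      ... | no xn≢0  = contradiction (n , b≤n , xn≢0) none

    enum : ℕ → ℕ
    enum zero    = proj₁ (support-unbounded 0)
    enum (suc i) = proj₁ (support-unbounded (suc (enum i)))

    enum-step : ∀ i → enum i < enum (suc i)
    enum-step i = proj₁ (proj₂ (support-unbounded (suc (enum i))))

    enum-support : ∀ i → x (enum i) ≢ 0
    enum-support zero    = proj₂ (proj₂ (support-unbounded 0))
    enum-support (suc i) = proj₂ (proj₂ (support-unbounded (suc (enum i))))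

    -- Branches of the binary tree carried into the support of `x`, where subtracting 1 is a genuine
    -- decrease.
    S : (ℕ → Bool) → Pred ℕ 0ℓ
    S f k = ∃[ n ] k ≡ enum (code f n)

    S-support : ∀ {f k} → S f k → x k ≢ 0
    S-support {f} (n , refl) = enum-support (code f n)

    S-infinite : ∀ f {Q : Pred ℕ 0ℓ} → ∀* Q → ∃[ k ] (S f k × Q k)
    S-infinite f ∀*Q = let b , q = ∀*⇒eventually ∀*Q in
      enum (code f b) , (b , refl) ,
      q _ (≤-trans (n≤code f b) (step-<⇒n≤e[n] enum enum-step (code f b)))

    S-almostDisjoint : ∀ {f g i} → f i ≢ g i → ∀* (λ k → ¬ (S f k × S g k))
    S-almostDisjoint {f} {g} {i} fi≢gi =
      -- The exceptions are the points of `S f` at levels 0 to `i`; at later levels the prefix is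
      -- long enough to contain coordinate `i`.
      applyUpTo (enum ∘ code f) (suc i) , λ k k∉ → λ
        { ((m , refl) , (n , eq)) → fi≢gi
            (code-agree f g {m} {n} (step-<⇒injective enum enum-step eq)
              (≰⇒> λ m≤i → k∉ (∈-applyUpTo⁺ (enum ∘ code f) (s≤s m≤i)))) }

    Traces : (ℕ → Bool) → Pred ℕ 0ℓ → Set
    Traces f D = ¬ ∀* (λ k → ¬ D k) × ∀* (λ k → D k → S f k)

    -- An infinite set cannot be almost contained in two almost disjoint sets.
    Traces-functional : ∀ {f g D} → Traces f D → Traces g D → f ≗ g
    Traces-functional {f} {g} (inf , D⊆f) (_ , D⊆g) i with f i ≟ᵇ g i
    ... | yes fi≡gi = fi≡gi
    ... | no fi≢gi  = contradiction
      (∀*-map (λ { ((d⇒f , d⇒g) , ¬fg) d → ¬fg (d⇒f d , d⇒g d) })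
        (∀*-zip (∀*-zip D⊆f D⊆g) (S-almostDisjoint fi≢gi)))
      inf

    module _ (f g : ℕ → Bool) where

      -- Points common to both sets are raised; for distinct `f` and `g` there are only finitely
      -- many of them.
      bump : ω^ω
      bump k with em {P = S f k} | em {P = S g k}
      ... | yes _ | _     = suc (x k)
      ... | no _  | yes _ = pred (x k)
      ... | no _  | no _  = x k

      bump-up : ∀ {k} → S f k → bump k ≡ suc (x k)
      bump-up {k} k∈f with em {P = S f k} | em {P = S g k}
      ... | yes _  | _ = refl
      ... | no k∉f | _ = contradiction k∈f k∉f

      bump-down : ∀ {k} → S g k → ¬ S f k → bump k ≡ pred (x k)
      bump-down {k} k∈g k∉f with em {P = S f k} | em {P = S g k}
      ... | yes k∈f | _      = contradiction k∈f k∉f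
      ... | no _    | yes _  = refl
      ... | no _    | no k∉g = contradiction k∈g k∉g

      x<bump⇒S : ∀ {k} → x k < bump k → S f k
      x<bump⇒S {k} x<p with em {P = S f k} | em {P = S g k}
      ... | yes k∈f | _     = k∈f
      ... | no _    | yes _ = contradiction pred[n]≤n (<⇒≱ x<p)
      ... | no _    | no _  = contradiction ≤-refl (<⇒≱ x<p)

      bump<x⇒S : ∀ {k} → bump k < x k → S g k
      bump<x⇒S {k} p<x with em {P = S f k} | em {P = S g k}
      ... | yes _ | _       = contradiction (n≤1+n (x k)) (<⇒≱ p<x)
      ... | no _  | yes k∈g = k∈g
      ... | no _  | no _    = contradiction ≤-refl (<⇒≱ p<x)

      bump∉𝟘 : ¬ 𝟘 bump
      bump∉𝟘 p≡0 with k , k∈f , pk≡0 ← S-infinite f p≡0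
        with () ← trans (sym (bump-up k∈f)) pk≡0

      bump≰x : ¬ (bump ≤* x)
      bump≰x p≤x with k , k∈f , pk≤xk ← S-infinite f p≤x =
        <⇒≱ (n<1+n (x k)) (subst (_≤ x k) (bump-up k∈f) pk≤xk)

      -- Almost all of the infinite set `S g` avoids `S f`; there `bump` takes the predecessor of a
      -- nonzero value, a strict drop.
      x≰bump : ∀ {i} → f i ≢ g i → ¬ (x ≤* bump)
      x≰bump fi≢gi x≤p
        with k , k∈g , xk≤pk , ¬fg ← S-infinite g (∀*-zip x≤p (S-almostDisjoint fi≢gi))
        = x≰pred (S-support k∈g)
            (subst (x k ≤_) (bump-down k∈g (λ k∈f → ¬fg (k∈f , k∈g))) xk≤pk)
        where
        x≰pred : ∀ {n} → n ≢ 0 → ¬ (n ≤ pred n)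
        x≰pred {zero}  0≢0 _   = 0≢0 refl
        x≰pred {suc n} _   n<n = <-irrefl refl n<n

  -- The cardinality of a maximal antichain

  ¬∀*≮⇐≰* : ∀ {x y : ω^ω} → ¬ (x ≤* y) → ¬ ∀* (λ k → ¬ (y k < x k))
  ¬∀*≮⇐≰* x≰y = x≰y ∘ ∀*-map ≮⇒≥

  Carrier* : Set
  Carrier* = Preorder.Carrier ω^ω∖𝟘

  module Size {M : Pred Carrier* 0ℓ} (M-max : IsMaximalAntichain ω^ω∖𝟘 M) where

    -- Any element outside `𝟘` would do: comparability with it shows that `M` is inhabited.
    one : Carrier*
    one = (λ _ → 1) , λ 1≡0 →
      let b , 1≡0-beyond = ∀*⇒eventually 1≡0 in contradiction (1≡0-beyond b ≤-refl) λ ()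

    base : ∃ M
    base = let m , m∈M , _ = maximal⇒comparable ω^ω∖𝟘 M-max one in m , m∈M

    x : ω^ω
    x = proj₁ (proj₁ base)

    open AlmostDisjoint (proj₂ (proj₁ base))

    Above Below : Carrier* → Pred ℕ 0ℓ
    Above (m , _) k = x k < m k
    Below (m , _) k = m k < x k

    Marked : (Carrier* → Pred ℕ 0ℓ) → (ℕ → Bool) → Set
    Marked D f = ∃[ m ] (M m × Traces f (D m))

    incomparable : ∀ {m} → M m → ¬ (proj₁ m ≗ x) → ¬ (proj₁ m ≤* x) × ¬ (x ≤* proj₁ m)
    incomparable m∈M = proj₁ M-max m∈M (proj₂ base)

    marked : ∀ {f g i} → f i ≢ g i → Marked Above f ⊎ Marked Below g
    marked {f} {g} fi≢gi
      with maximal⇒comparable ω^ω∖𝟘 M-max (bump f g , bump∉𝟘 f g)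
    ... | m , m∈M , inj₁ m≤p = inj₁ (m , m∈M ,
      ¬∀*≮⇐≰* (proj₁ (incomparable {m} m∈M m≢x)) ,
      ∀*-map (λ mk≤pk xk<mk → x<bump⇒S f g (<-≤-trans xk<mk mk≤pk)) m≤p)
      where
      m≢x : ¬ (proj₁ m ≗ x)
      m≢x m≗x = x≰bump f g fi≢gi
        (∀*-map (λ {k} → subst (_≤ bump f g k) (m≗x k)) m≤p)
    ... | m , m∈M , inj₂ p≤m = inj₂ (m , m∈M ,
      ¬∀*≮⇐≰* (proj₂ (incomparable {m} m∈M m≢x)) ,
      ∀*-map (λ pk≤mk mk<xk → bump<x⇒S f g (≤-<-trans pk≤mk mk<xk)) p≤m)
      where
      m≢x : ¬ (proj₁ m ≗ x)
      m≢x m≗x = bump≰x f g (∀*-map (λ {k} → subst (bump f g k ≤_) (m≗x k)) p≤m)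

    cons : Bool → (ℕ → Bool) → ℕ → Bool
    cons b f zero    = b
    cons b f (suc n) = f n

    dichotomy : (∀ f → Marked Above f) ⊎ (∃[ b ] ∀ g → Marked Below (cons b g))
    dichotomy with em {P = ∀ f → Marked Above f}
    ... | yes all = inj₁ all
    -- Sequences beginning with the opposite of `f 0` all differ from `f` at index 0, and they still
    -- form a copy of 2^ω.
    ... | no ¬all with f , ¬above ← ¬∀⇒∃¬ ¬all = inj₂ (not (f 0) , λ g →
      [ (λ above → contradiction above ¬above) , id ]′
        (marked {f} {cons (not (f 0)) g} {0} (not-¬ refl)))

    -- Distinct proofs of membership in ω^ω∖𝟘 are ignored by D = Above, Below.
    marks-injection : ∀ {D : ω^ω → Pred ℕ 0ℓ} (c : (ℕ → Bool) → ℕ → Bool) →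
      (∀ {f g} → c f ≗ c g → f ≗ g) → (∀ f → Marked (D ∘ proj₁) (c f)) →
      elementsOf ω^ω∖𝟘 M HasSizeAtLeast 𝔠
    marks-injection {D} c c-injective mark = record
      { to        = λ f → let m , m∈M , _ = mark f in m , m∈M
      ; cong      = λ {f} {g} f≗g k → cong (λ h → proj₁ (proj₁ (mark h)) k) (ext f≗g)
      ; injective = λ {f} {g} eq → c-injective (Traces-functional
          (subst (λ m → Traces (c f) (D m)) (ext eq) (proj₂ (proj₂ (mark f))))
          (proj₂ (proj₂ (mark g))))
      }

    atLeast𝔠 : elementsOf ω^ω∖𝟘 M HasSizeAtLeast 𝔠
    atLeast𝔠 with dichotomy
    ... | inj₁ above       = marks-injection {λ m k → x k < m k} id id above
    ... | inj₂ (b , below) =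
      marks-injection {λ m k → m k < x k} (cons b) (λ eq i → eq (suc i)) below

    -- For the upper bound: `pair` turns the graph of a function into a set of numbers, which embeds
    -- ω^ω into 2^ω.
    graph : ω^ω → ℕ → Bool
    graph y k = ⌊ em {P = ∃[ i ] k ≡ pair i (y i)} ⌋

    graph-injective : ∀ {y z} → graph y ≗ graph z → y ≗ z
    graph-injective {y} {z} eq i
      with j , same ← toWitness (subst T (eq (pair i (y i))) (fromWitness (i , refl)))
      with refl , yi≡zj ← pair-injective i j same = yi≡zj

    atMost𝔠 : Injection (elementsOf ω^ω∖𝟘 M) 𝔠
    atMost𝔠 = record
      { to        = graph ∘ proj₁ ∘ proj₁
      ; cong      = λ y≗z k → cong (λ y → graph y k) (ext y≗z)
      ; injective = graph-injective
      }

    size𝔠 : elementsOf ω^ω∖𝟘 M HasSize 𝔠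
    size𝔠 = CantorBernstein.bijection atMost𝔠 atLeast𝔠

mainTheorem3 : (∀ {ℓ} → ExcludedMiddle ℓ) → (∀ {a b} → Extensionality a b) →
    (∀ M → IsMaximalAntichain ω^ω∖𝟘 M → elementsOf ω^ω∖𝟘 M HasSize 𝔠) ×
    𝔪𝔞𝔠≡ ω^ω∖𝟘 𝔠
mainTheorem3 em ext = (λ M → Size.size𝔠) ,
  -- The minimum has to be attained, so a maximal antichain must exist; any one has the right size.
  (let M , M-max = Tower.maximalAntichain ω^ω∖𝟘 in M , M-max , Size.size𝔠 M-max) ,
  (λ M → Size.atLeast𝔠)
  where open Classical em ext
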